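{- Let $q$ be a power of $2$ and let \[ f(X)=X+\frac{1}{X-r}+\frac{1}{X-r^q}\in\mathbb{F}_q(X), \] where $r\in\mathbb{F}_{q^2}\setminus\mathbb{F}_q$. Then $f$ is a permutation rational function of $\mathbb{P}^1(\mathbb{F}_q)$ if and only if $r+r^q=1$.
   Context: $\mathbb{P}^1(\mathbb{F}_q)=\mathbb{F}_q\cup\{\infty\}$ is the projective line over $\mathbb{F}_q$. A rational function $f=P/Q\in\mathbb{F}_q(X)$ ($P,Q$ coprime) defines a map $\mathbb{P}^1(\mathbb{F}_q)\to\mathbb{P}^1(\mathbb{F}_q)$ in the usual way (zeros of $Q$ map to $\infty$, and $f(\infty)$ is the limiting value). A permutation rational function of $\mathbb{P}^1(\mathbb{F}_q)$ is a rational function whose induced map on $\mathbb{P}^1(\mathbb{F}_q)$ is a bijection. -}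

module Defs where

open import Level using (Level; _⊔_) renaming (suc to lsuc)
open import Data.Nat using (ℕ; suc) renaming (_^_ to _^ℕ_)
open import Data.List using (List; length)
open import Data.List.Relation.Unary.Any using (Any)
open import Data.List.Relation.Unary.AllPairs using (AllPairs)
open import Data.Maybe using (Maybe; just; nothing)
open import Data.Product using (_×_; Σ; ∃; _,_)
open import Data.Unit.Polymorphic using (⊤)
open import Data.Empty.Polymorphic using (⊥)
open import Relation.Nullary using (¬_)
open import Algebra.Bundles using (CommutativeRing)

-- A field: a commutative ring with 0 ≠ 1 in which every nonzero element
-- has a multiplicative inverse (given by a total operation _⁻¹ whose value
-- at 0 is irrelevant).
record Field (c ℓ : Level) : Set (lsuc (c ⊔ ℓ)) where
  field
    commRing : CommutativeRing c ℓ
  open CommutativeRing commRing public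
  field
    _⁻¹      : Carrier → Carrier
    0≉1      : ¬ (0# ≈ 1#)
    ⁻¹-inverse : ∀ x → ¬ (x ≈ 0#) → x * (x ⁻¹) ≈ 1#

  _^_ : Carrier → ℕ → Carrier
  x ^ ℕ.zero = 1#
  x ^ suc n  = x * (x ^ n)

  _÷_ : Carrier → Carrier → Carrier
  a ÷ b = a * (b ⁻¹)

HasCard : ∀ {c ℓ} → Field c ℓ → ℕ → Set (c ⊔ ℓ)
HasCard K m = Σ (List Carrier) λ xs →
    (length xs ≡ m) × AllPairs (λ x y → ¬ (x ≈ y)) xs × (∀ x → Any (x ≈_) xs)
  where
    open Field K
    open import Relation.Binary.PropositionalEquality using (_≡_)

module _ {c ℓ} (K : Field c ℓ) (q : ℕ) where
  open Field K

  -- The subfield F_q = { x ∈ K | x^q = x } (when |K| = q²).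
  InFq : Carrier → Set ℓ
  InFq x = x ^ q ≈ x

  -- Points of P¹: nothing = ∞, just x = x.
  P1 : Set c
  P1 = Maybe Carrier

  InP1Fq : P1 → Set ℓ
  InP1Fq nothing  = ⊤
  InP1Fq (just x) = InFq x

  _≈P_ : P1 → P1 → Set ℓ
  nothing ≈P nothing = ⊤
  nothing ≈P just _  = ⊥
  just _  ≈P nothing = ⊥
  just x  ≈P just y  = x ≈ y

  PermutesP1Fq : (P1 → P1) → Set (c ⊔ ℓ)
  PermutesP1Fq g =
      (∀ p → InP1Fq p → InP1Fq (g p))
    × (∀ p p′ → InP1Fq p → InP1Fq p′ → g p ≈P g p′ → p ≈P p′)
    × (∀ p′ → InP1Fq p′ → ∃ λ p → InP1Fq p × (g p ≈P p′))

  -- The map on P¹(F_q) induced by f(X) = X + 1/(X - r) + 1/(X - r^q),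
  -- for r ∈ F_{q²} \ F_q.  Since r, r^q ∉ F_q, the denominators do not
  -- vanish at points of F_q, so f(x) is given by the formula there;
  -- f(∞) = ∞ because f = X + (lower-degree rational function).
  fMap : Carrier → P1 → P1
  fMap r nothing  = nothing
  fMap r (just x) = just (x + (1# ÷ (x - r)) + (1# ÷ (x - (r ^ q))))

{-# OPTIONS --safe #-}

-- Write r̄ = r^q, t = r + r̄ ∈ F_q*, w(x) = 1/(x + r), so that f = x + w + w̄ on F_q.
--
-- If f permutes F_q, then Σ f(x)³ = Σ x³. Expanding, and using that x ↦ x + t exchanges
-- w and w̄, this becomes t²p + tp² = 0 for p = Σ w(x). Multiplication by r permutes the
-- projective line of K over F_q, i.e. x ↦ r r̄ / (t + x) permutes F_q ∪ {∞}; summing the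
-- resulting relation r w(r r̄ / (t + x)) = 1 + r̄ w(x) (off by 1 at x = t) gives tp = 1.
-- Hence t + p = 0 and t² = 1, so t = 1.
--
-- If t = 1 and f(x) = f(y), put d = x + y and u = x + r. Clearing denominators gives
-- d A Ā = 0 with A = u d + u ū + 1. If A = 0, then d = A + Ā = 0; so x = y in any case.
module Submission where

open import Defs
open import Level using (_⊔_)
open import Data.Nat using (ℕ; zero; suc; _≥_) renaming (_^_ to _^ℕ_; _+_ to _+ℕ_; _*_ to _*ℕ_)
open import Data.Nat.Properties using (n<1+n; ^-distribˡ-+-*) renaming (*-identityʳ to *ℕ-identityʳ)
open import Data.Bool using (Bool; true; false; _xor_; _∧_; if_then_else_)
open import Data.Bool.Properties using () renaming (_≟_ to _≟ᵇ_)
open import Data.Empty using (⊥-elim)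
open import Data.Unit using (⊤; tt)
open import Data.Fin using (Fin; zero; suc; punchIn; punchOut)
open import Data.Fin.Properties using (any?; <⇒notInjective; punchOut-injective; punchInᵢ≢i) renaming (_≟_ to _≟ᶠ_)
open import Data.Fin.Permutation using (Permutation′; permutation)
open import Data.List using (List; length; lookup; filter)
open import Data.List.Relation.Unary.Any using (Any; index)
open import Data.List.Relation.Unary.Any.Properties using (lookup-index)
open import Data.List.Relation.Unary.All as All using (All)
open import Data.List.Relation.Unary.All.Properties using (all-filter)
open import Data.List.Relation.Unary.AllPairs using (AllPairs; _∷_)
open import Data.List.Relation.Unary.AllPairs.Properties using () renaming (filter⁺ to AllPairs-filter⁺)
open import Data.List.Membership.Propositional.Properties using (∈-lookup)
open import Data.List.Membership.Setoid.Properties using (∈-filter⁺)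
open import Data.Maybe as Maybe using (just; nothing)
open import Data.Product using (_×_; ∃; _,_; proj₁; proj₂)
open import Data.Sum using (_⊎_; inj₁; inj₂; [_,_]′)
open import Function using (_∘_; id)
open import Function.Bundles using (_⇔_; mk⇔)
open import Function.Definitions using (Injective)
open import Relation.Nullary using (¬_; Dec; yes; no; does)
open import Relation.Nullary.Decidable using (dec⇒maybe)
open import Relation.Binary.Bundles using (Setoid)
open import Relation.Binary.Definitions using (Decidable)
open import Relation.Binary.PropositionalEquality as ≡ using (_≡_; _≢_)
open import Algebra.Bundles using (CommutativeMonoid; CommutativeRing; RawRing)
open import Algebra.Solver.Ring.AlmostCommutativeRing using (fromCommutativeRing; _-Raw-AlmostCommutative⟶_)
import Algebra.Properties.CommutativeMonoid.Sum as MonoidSum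
import Algebra.Properties.CommutativeSemigroup as CommutativeSemigroupProperties
import Algebra.Properties.Group as GroupProperties
import Algebra.Properties.Semiring.Mult as SemiringMult
import Algebra.Properties.Semiring.Sum as SemiringSum
import Algebra.Solver.Ring as RingSolver
import Relation.Binary.Reasoning.Setoid as SetoidReasoning

-- Finite sets: enumerations, sums and reindexing

injective⇒surjective : ∀ {m} (σ : Fin m → Fin m) → Injective _≡_ _≡_ σ → ∀ j → ∃ λ i → σ i ≡ j
injective⇒surjective {suc m} σ σ-inj j with any? (λ i → σ i ≟ᶠ j)
... | yes hit = hit
-- Pigeonhole: punching out the missed value `j` would give an injection of `Fin (suc m)` into
-- `Fin m`.
... | no miss = ⊥-elim (<⇒notInjective {f = σ′} (n<1+n m) σ′-inj)
  where
  avoids : ∀ i → j ≢ σ i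
  avoids i j≡σi = miss (i , ≡.sym j≡σi)

  σ′ : Fin (suc m) → Fin m
  σ′ i = punchOut (avoids i)

  σ′-inj : Injective _≡_ _≡_ σ′
  σ′-inj {i} {k} eq = σ-inj (punchOut-injective (avoids i) (avoids k) eq)

module FiniteSum {a ℓ} (M : CommutativeMonoid a ℓ) where
  open CommutativeMonoid M
  open MonoidSum M using (sum; sum-remove; sum-cong-≋; sum-replicate-zero)

  sum-single : ∀ {n} (t : Fin n → Carrier) j → (∀ i → i ≢ j → t i ≈ ε) → sum t ≈ t j
  sum-single {suc n} t j others =
    trans (sum-remove {i = j} t)
      (trans (∙-congˡ (trans (sum-cong-≋ λ k → others (punchIn j k) (punchInᵢ≢i j k))
                             (sum-replicate-zero n)))
             (identityʳ (t j)))

module FiniteSet {c ℓ} (S : Setoid c ℓ) where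
  open Setoid S

  -- Indexing by `Fin size` makes sums over `Fin`, and their invariance under permutations of the
  -- indices, available for subsets of a setoid.
  record Enumeration {p} (P : Carrier → Set p) : Set (c ⊔ ℓ ⊔ p) where
    field
      size       : ℕ
      elem       : Fin size → Carrier
      elem-∈     : ∀ i → P (elem i)
      elem-inj   : ∀ {i j} → elem i ≈ elem j → i ≡ j
      position   : ∀ {x} → P x → ∃ λ i → elem i ≈ x

  lookup-injective : ∀ {xs} → AllPairs (λ x y → ¬ (x ≈ y)) xs → ∀ {i j} → lookup xs i ≈ lookup xs j → i ≡ j
  lookup-injective (x∉ ∷ xs!) {zero}  {zero}  eq = ≡.refl
  lookup-injective (x∉ ∷ xs!) {zero}  {suc j} eq = ⊥-elim (All.lookup x∉ (∈-lookup j) eq)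
  lookup-injective (x∉ ∷ xs!) {suc i} {zero}  eq = ⊥-elim (All.lookup x∉ (∈-lookup i) (sym eq))
  lookup-injective (x∉ ∷ xs!) {suc i} {suc j} eq = ≡.cong suc (lookup-injective xs! eq)

  enumerate : ∀ {p} {P : Carrier → Set p} (xs : List Carrier) → All P xs →
              AllPairs (λ x y → ¬ (x ≈ y)) xs → (∀ {x} → P x → Any (x ≈_) xs) → Enumeration P
  enumerate xs Pxs xs! complete = record
    { size     = length xs
    ; elem     = lookup xs
    ; elem-∈   = λ i → All.lookup Pxs (∈-lookup i)
    ; elem-inj = lookup-injective xs!
    ; position = λ Px → index (complete Px) , sym (lookup-index (complete Px))
    }

  module SelfMap {p} {P : Carrier → Set p} (E : Enumeration P) (φ : Carrier → Carrier)
                 (φ-closed : ∀ {x} → P x → P (φ x))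
                 (φ-inj : ∀ {x y} → P x → P y → φ x ≈ φ y → x ≈ y) where
    open Enumeration E

    onIndices : Fin size → Fin size
    onIndices i = proj₁ (position (φ-closed (elem-∈ i)))

    elem-onIndices : ∀ i → elem (onIndices i) ≈ φ (elem i)
    elem-onIndices i = proj₂ (position (φ-closed (elem-∈ i)))

    onIndices-injective : Injective _≡_ _≡_ onIndices
    onIndices-injective {i} {j} eq = elem-inj (φ-inj (elem-∈ i) (elem-∈ j)
      (trans (sym (elem-onIndices i)) (trans (reflexive (≡.cong elem eq)) (elem-onIndices j))))

    onIndices-surjective : ∀ j → ∃ λ i → onIndices i ≡ j
    onIndices-surjective = injective⇒surjective onIndices onIndices-injective

    surjective : ∀ {y} → P y → ∃ λ x → P x × φ x ≈ y
    surjective Py with position Py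
    ... | j , ej≈y with onIndices-surjective j
    ... | i , σi≡j = elem i , elem-∈ i ,
      trans (sym (elem-onIndices i)) (trans (reflexive (≡.cong elem σi≡j)) ej≈y)

    permute : Permutation′ size
    permute = permutation onIndices (proj₁ ∘ onIndices-surjective)
      (proj₂ ∘ onIndices-surjective)
      (λ i → onIndices-injective (proj₂ (onIndices-surjective (onIndices i))))

    module _ {a ℓ′} (M : CommutativeMonoid a ℓ′) where
      private module M = CommutativeMonoid M
      open MonoidSum M using (sum; sum-permute; sum-cong-≋)

      -- An injective self-map of a finite set is a permutation of it. The monoid is arbitrary
      -- because both sums over a field and products over its units are reindexed this way.
      sum-reindex : (h : Carrier → M.Carrier) → (∀ {x y} → x ≈ y → h x M.≈ h y) →
                    sum (h ∘ φ ∘ elem) M.≈ sum (h ∘ elem)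
      sum-reindex h h-cong = M.trans
        (sum-cong-≋ λ i → h-cong (sym (elem-onIndices i)))
        (M.sym (sum-permute (h ∘ elem) permute))

-- Characteristic two

𝔽₂ : RawRing _ _
𝔽₂ = record
  { Carrier = Bool ; _≈_ = _≡_ ; _+_ = _xor_ ; _*_ = _∧_ ; -_ = id ; 0# = false ; 1# = true }

module CharTwo {c ℓ} (R : CommutativeRing c ℓ)
               (1+1≈0 : CommutativeRing._≈_ R
                  (CommutativeRing._+_ R (CommutativeRing.1# R) (CommutativeRing.1# R))
                  (CommutativeRing.0# R)) where
  open CommutativeRing R
  open SetoidReasoning setoid
  open GroupProperties +-group using (inverseʳ-unique)

  x+x≈0 : ∀ x → x + x ≈ 0#
  x+x≈0 x = begin
    x + x           ≈⟨ +-cong (*-identityˡ x) (*-identityˡ x) ⟨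
    1# * x + 1# * x ≈⟨ distribʳ x 1# 1# ⟨
    (1# + 1#) * x   ≈⟨ *-congʳ 1+1≈0 ⟩
    0# * x          ≈⟨ zeroˡ x ⟩
    0#              ∎

  -x≈x : ∀ x → - x ≈ x
  -x≈x x = sym (inverseʳ-unique x x (x+x≈0 x))

  x≈y⇒x+y≈0 : ∀ {x y} → x ≈ y → x + y ≈ 0#
  x≈y⇒x+y≈0 {x} {y} x≈y = trans (+-congʳ x≈y) (x+x≈0 y)

  x+y≈0⇒x≈y : ∀ {x y} → x + y ≈ 0# → x ≈ y
  x+y≈0⇒x≈y {x} {y} x+y≈0 = trans (sym (-x≈x x)) (sym (inverseʳ-unique x y x+y≈0))

  fromBool : Bool → Carrier
  fromBool false = 0#
  fromBool true  = 1#

  𝔽₂⟶R : 𝔽₂ -Raw-AlmostCommutative⟶ fromCommutativeRing R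
  𝔽₂⟶R = record
    { ⟦_⟧    = fromBool
    ; +-homo = λ { false y → sym (+-identityˡ _) ; true false → sym (+-identityʳ _) ; true true → sym 1+1≈0 }
    ; *-homo = λ { false y → sym (zeroˡ _) ; true y → sym (*-identityˡ _) }
    ; -‿homo = λ x → sym (-x≈x (fromBool x))
    ; 0-homo = refl
    ; 1-homo = refl
    }

  -- With coefficients in `𝔽₂` the normaliser cancels equal terms in pairs, so identities that hold
  -- only in characteristic two are closed by `refl`.
  module Solver = RingSolver 𝔽₂ (fromCommutativeRing R) 𝔽₂⟶R
    (λ a b → Maybe.map (λ a≡b → reflexive (≡.cong fromBool a≡b)) (dec⇒maybe (a ≟ᵇ b)))

-- Fields with decidable equality: inverses and powers

module DiscreteField {c ℓ} (K : Field c ℓ) (_≟_ : Decidable (Field._≈_ K)) where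
  open Field K hiding (zero)
  open SetoidReasoning setoid

  1≉0 : ¬ (1# ≈ 0#)
  1≉0 = 0≉1 ∘ sym

  *-zero-divisor-free : ∀ {x y} → x * y ≈ 0# → x ≈ 0# ⊎ y ≈ 0#
  *-zero-divisor-free {x} {y} xy≈0 with x ≟ 0#
  ... | yes x≈0 = inj₁ x≈0
  ... | no  x≉0 = inj₂ (begin
    y                ≈⟨ *-identityˡ y ⟨
    1# * y           ≈⟨ *-congʳ (trans (*-comm _ _) (⁻¹-inverse x x≉0)) ⟨
    ((x ⁻¹) * x) * y ≈⟨ *-assoc _ _ _ ⟩
    (x ⁻¹) * (x * y) ≈⟨ *-congˡ xy≈0 ⟩
    (x ⁻¹) * 0#      ≈⟨ zeroʳ _ ⟩
    0#               ∎)

  *-≉0 : ∀ {x y} → ¬ (x ≈ 0#) → ¬ (y ≈ 0#) → ¬ (x * y ≈ 0#)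
  *-≉0 x≉0 y≉0 = [ x≉0 , y≉0 ]′ ∘ *-zero-divisor-free

  *-cancelʳ-≉0 : ∀ {x y z} → ¬ (z ≈ 0#) → x * z ≈ y * z → x ≈ y
  *-cancelʳ-≉0 {x} {y} {z} z≉0 xz≈yz = begin
    x                ≈⟨ absorb x ⟨
    (x * z) * (z ⁻¹) ≈⟨ *-congʳ xz≈yz ⟩
    (y * z) * (z ⁻¹) ≈⟨ absorb y ⟩
    y                ∎
    where
    absorb : ∀ u → (u * z) * (z ⁻¹) ≈ u
    absorb u = trans (*-assoc _ _ _) (trans (*-congˡ (⁻¹-inverse z z≉0)) (*-identityʳ u))

  -- Unlike _⁻¹, which need not respect _≈_ at 0#, this inverse is a congruence.
  inv : Carrier → Carrier
  inv x = if does (x ≟ 0#) then 0# else x ⁻¹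

  inv-zero : ∀ {x} → x ≈ 0# → inv x ≈ 0#
  inv-zero {x} x≈0 with x ≟ 0#
  ... | yes _   = refl
  ... | no  x≉0 = ⊥-elim (x≉0 x≈0)

  inv-inverseʳ : ∀ {x} → ¬ (x ≈ 0#) → x * inv x ≈ 1#
  inv-inverseʳ {x} x≉0 with x ≟ 0#
  ... | yes x≈0 = ⊥-elim (x≉0 x≈0)
  ... | no  _   = ⁻¹-inverse x x≉0

  x*y≈1⇒x≉0 : ∀ {x y} → x * y ≈ 1# → ¬ (x ≈ 0#)
  x*y≈1⇒x≉0 xy≈1 x≈0 = 0≉1 (trans (sym (trans (*-congʳ x≈0) (zeroˡ _))) xy≈1)

  inverse-unique : ∀ {x y z} → x * y ≈ 1# → x * z ≈ 1# → y ≈ z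
  inverse-unique {x} xy≈1 xz≈1 = *-cancelʳ-≉0 (x*y≈1⇒x≉0 xy≈1)
    (trans (*-comm _ x) (trans xy≈1 (trans (sym xz≈1) (*-comm x _))))

  inv-unique : ∀ {x y} → x * y ≈ 1# → inv x ≈ y
  inv-unique xy≈1 = inverse-unique (inv-inverseʳ (x*y≈1⇒x≉0 xy≈1)) xy≈1

  inv-cong : ∀ {x y} → x ≈ y → inv x ≈ inv y
  inv-cong {x} {y} x≈y with y ≟ 0#
  ... | yes y≈0 = inv-zero (trans x≈y y≈0)
  ... | no  y≉0 = inv-unique (trans (*-congʳ x≈y) (⁻¹-inverse y y≉0))

  inv-involutive : ∀ x → inv (inv x) ≈ x
  inv-involutive x with x ≟ 0#
  ... | yes x≈0 = trans (inv-zero refl) (sym x≈0)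
  ... | no  x≉0 = inv-unique (trans (*-comm _ x) (⁻¹-inverse x x≉0))

  inv-injective : ∀ {x y} → inv x ≈ inv y → x ≈ y
  inv-injective {x} {y} eq = trans (sym (inv-involutive x)) (trans (inv-cong eq) (inv-involutive y))

  ⁻¹≈inv : ∀ {x y} → ¬ (y ≈ 0#) → x ≈ y → x ⁻¹ ≈ inv y
  ⁻¹≈inv y≉0 x≈y = sym (inv-unique
    (trans (*-congʳ (sym x≈y)) (⁻¹-inverse _ (y≉0 ∘ trans (sym x≈y)))))

  divide : ∀ {x y z} → ¬ (x ≈ 0#) → x * z ≈ y → y * inv x ≈ z
  divide {x} {y} {z} x≉0 xz≈y = *-cancelʳ-≉0 x≉0 (begin
    (y * inv x) * x ≈⟨ *-assoc _ _ _ ⟩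
    y * (inv x * x) ≈⟨ *-congˡ (trans (*-comm _ _) (inv-inverseʳ x≉0)) ⟩
    y * 1#          ≈⟨ *-identityʳ y ⟩
    y               ≈⟨ xz≈y ⟨
    x * z           ≈⟨ *-comm x z ⟩
    z * x           ∎)

  ^-cong : ∀ {x y} n → x ≈ y → x ^ n ≈ y ^ n
  ^-cong zero    x≈y = refl
  ^-cong (suc n) x≈y = *-cong x≈y (^-cong n x≈y)

  1^n≈1 : ∀ n → 1# ^ n ≈ 1#
  1^n≈1 zero    = refl
  1^n≈1 (suc n) = trans (*-identityˡ _) (1^n≈1 n)

  ^-+ : ∀ x m n → x ^ (m +ℕ n) ≈ (x ^ m) * (x ^ n)
  ^-+ x zero    n = sym (*-identityˡ _)
  ^-+ x (suc m) n = trans (*-congˡ (^-+ x m n)) (sym (*-assoc _ _ _))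

  ^-* : ∀ x m n → x ^ (m *ℕ n) ≈ (x ^ n) ^ m
  ^-* x zero    n = refl
  ^-* x (suc m) n = trans (^-+ x n (m *ℕ n)) (*-congˡ (^-* x m n))

  ^-distrib-* : ∀ x y n → (x * y) ^ n ≈ (x ^ n) * (y ^ n)
  ^-distrib-* x y zero    = sym (*-identityˡ _)
  ^-distrib-* x y (suc n) = begin
    (x * y) * ((x * y) ^ n)         ≈⟨ *-congˡ (^-distrib-* x y n) ⟩
    (x * y) * ((x ^ n) * (y ^ n))   ≈⟨ interchange x y (x ^ n) (y ^ n) ⟩
    (x * (x ^ n)) * (y * (y ^ n))   ∎
    where open CommutativeSemigroupProperties *-commutativeSemigroup using (interchange)

  open FiniteSet setoid public

  module _ {p} {P : Carrier → Set p} (E : Enumeration P) (closed : ∀ {x} → P x → P (x + 1#)) where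
    open Enumeration E
    open SemiringSum semiring using (sum; ∑-distrib-+)
    open GroupProperties +-group using (identityʳ-unique; ∙-cancelʳ)

    -- Translating the enumerated set by 1# does not change the sum of its elements.
    sum-ones≈0 : sum {size} (λ _ → 1#) ≈ 0#
    sum-ones≈0 = identityʳ-unique (sum elem) _ (begin
      sum elem + sum {size} (λ _ → 1#) ≈⟨ ∑-distrib-+ elem (λ _ → 1#) ⟨
      sum (λ i → elem i + 1#)          ≈⟨ sum-reindex +-commutativeMonoid id id ⟩
      sum elem                         ∎)
      where open SelfMap E (_+ 1#) closed (λ _ _ → ∙-cancelʳ 1# _ _)

  -- Finite fields: characteristic and Fermat's identity

  module Everything (E : Enumeration (λ _ → ⊤)) where
    open Enumeration E
    open SemiringMult semiring using (×1-homo-*) renaming (_×_ to _·_)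

    size·1≈0 : size · 1# ≈ 0#
    size·1≈0 = trans (sym (SemiringSum.sum-replicate semiring size)) (sum-ones≈0 E id)

    -- The image of `2 ^ℕ m` is a product of `m` factors `1# + 1#`, and a field has no zero
    -- divisors.
    2^m·1≈0⇒1+1≈0 : ∀ m → (2 ^ℕ m) · 1# ≈ 0# → 1# + 1# ≈ 0#
    2^m·1≈0⇒1+1≈0 zero    eq = ⊥-elim (1≉0 (trans (sym (+-identityʳ 1#)) eq))
    2^m·1≈0⇒1+1≈0 (suc m) eq with *-zero-divisor-free (trans (sym (×1-homo-* 2 (2 ^ℕ m))) eq)
    ... | inj₁ 2≈0  = trans (+-congˡ (sym (+-identityʳ 1#))) 2≈0
    ... | inj₂ eq′ = 2^m·1≈0⇒1+1≈0 m eq′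

    module ∏ = MonoidSum *-commutativeMonoid

    ∏-const : ∀ x n → ∏.sum {n} (λ _ → x) ≈ x ^ n
    ∏-const x zero    = refl
    ∏-const x (suc n) = *-congˡ (∏-const x n)

    ∏-≉0 : ∀ {n} (t : Fin n → Carrier) → (∀ i → ¬ (t i ≈ 0#)) → ¬ (∏.sum t ≈ 0#)
    ∏-≉0 {zero}  t t≉0 = 1≉0
    ∏-≉0 {suc n} t t≉0 = *-≉0 (t≉0 zero) (∏-≉0 (t ∘ suc) (t≉0 ∘ suc))

    -- 0# is replaced by 1#, so that products over all of K are products over its units.
    unit : Carrier → Carrier
    unit y = if does (y ≟ 0#) then 1# else y

    unit-≈0 : ∀ {y} → y ≈ 0# → unit y ≈ 1#
    unit-≈0 {y} y≈0 with y ≟ 0#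
    ... | yes _   = refl
    ... | no  y≉0 = ⊥-elim (y≉0 y≈0)

    unit-≉0 : ∀ {y} → ¬ (y ≈ 0#) → unit y ≈ y
    unit-≉0 {y} y≉0 with y ≟ 0#
    ... | yes y≈0 = ⊥-elim (y≉0 y≈0)
    ... | no  _   = refl

    unit-cong : ∀ {x y} → x ≈ y → unit x ≈ unit y
    unit-cong {x} {y} x≈y with y ≟ 0#
    ... | yes y≈0 = unit-≈0 (trans x≈y y≈0)
    ... | no  y≉0 = trans (unit-≉0 (y≉0 ∘ trans (sym x≈y))) x≈y

    unit≉0 : ∀ y → ¬ (unit y ≈ 0#)
    unit≉0 y with y ≟ 0#
    ... | yes _   = 1≉0
    ... | no  y≉0 = y≉0

    -- For nonzero `x`, the product of all `unit (x * y)` is a reindexing of the product of all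
    -- `unit y`. Comparing it with the product of all `x * unit y`, the factors agree except at
    -- `y = 0`, where one extra `x` appears. Hence the exponent `size` on one side and a single `x`
    -- on the other.
    fermat : ∀ x → x ^ size ≈ x
    fermat x with x ≟ 0#
    -- The position of `0#` inhabits `Fin size`, so the exponent is a successor; exponent zero would
    -- give `1#`.
    ... | yes x≈0 = trans (0^ (proj₁ (position {0#} tt))) (sym x≈0)
      where
      0^ : ∀ {n} → Fin n → x ^ n ≈ 0#
      0^ {suc n} _ = trans (*-congʳ x≈0) (zeroˡ _)
    ... | no x≉0 = *-cancelʳ-≉0 (∏-≉0 (unit ∘ elem) (unit≉0 ∘ elem)) (begin
      (x ^ size) * ∏.sum (unit ∘ elem)                ≈⟨ *-congʳ (∏-const x size) ⟨
      ∏.sum {size} (λ _ → x) * ∏.sum (unit ∘ elem)    ≈⟨ ∏.∑-distrib-+ {size} (λ _ → x) (unit ∘ elem) ⟨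
      ∏.sum (λ i → x * unit (elem i))                 ≈⟨ ∏.sum-cong-≋ (λ i → scale (elem i)) ⟩
      ∏.sum (λ i → at0 (elem i) * unit (x * elem i))  ≈⟨ ∏.∑-distrib-+ (at0 ∘ elem) (λ i → unit (x * elem i)) ⟩
      ∏.sum (at0 ∘ elem) * ∏.sum (λ i → unit (x * elem i))
        ≈⟨ *-cong ∏-at0 (sum-reindex *-commutativeMonoid unit unit-cong) ⟩
      x * ∏.sum (unit ∘ elem)                         ∎)
      where
      open SelfMap E (x *_) (λ _ → tt)
        (λ {y} {z} _ _ eq → *-cancelʳ-≉0 x≉0 (trans (*-comm y x) (trans eq (*-comm x z))))

      at0 : Carrier → Carrier
      at0 y = if does (y ≟ 0#) then x else 1#

      scale : ∀ y → x * unit y ≈ at0 y * unit (x * y)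
      scale y with y ≟ 0#
      ... | yes y≈0 = *-congˡ (sym (unit-≈0 (trans (*-congˡ y≈0) (zeroʳ x))))
      ... | no  y≉0 = sym (trans (*-identityˡ _) (unit-≉0 (*-≉0 x≉0 y≉0)))

      at0-≈0 : ∀ {y} → y ≈ 0# → at0 y ≈ x
      at0-≈0 {y} y≈0 with y ≟ 0#
      ... | yes _   = refl
      ... | no  y≉0 = ⊥-elim (y≉0 y≈0)

      at0-≉0 : ∀ {y} → ¬ (y ≈ 0#) → at0 y ≈ 1#
      at0-≉0 {y} y≉0 with y ≟ 0#
      ... | yes y≈0 = ⊥-elim (y≉0 y≈0)
      ... | no  _   = refl

      ∏-at0 : ∏.sum (at0 ∘ elem) ≈ x
      ∏-at0 with position {0#} tt
      ... | j , ej≈0 = trans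
        (FiniteSum.sum-single *-commutativeMonoid (at0 ∘ elem) j
          (λ i i≢j → at0-≉0 (λ ei≈0 → i≢j (elem-inj (trans ei≈0 (sym ej≈0))))))
        (at0-≈0 ej≈0)

-- Fields of characteristic two with an involution

module Involution {c ℓ} (K : Field c ℓ) (_≟_ : Decidable (Field._≈_ K))
                  (1+1≈0 : Field._≈_ K (Field._+_ K (Field.1# K) (Field.1# K)) (Field.0# K)) where
  open Field K hiding (zero)
  open DiscreteField K _≟_
  open CharTwo commRing 1+1≈0
  open Solver using (solve; _:=_; _:+_; _:*_; con)
  open SetoidReasoning setoid

  -- Abstracts the map sending `x` to its `q`-th power on the field of order `q * q`, whose fixed
  -- elements form the subfield of order `q`.
  record IsInvolution (_ᶜ : Carrier → Carrier) : Set (c ⊔ ℓ) where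
    field
      conj-cong       : ∀ {x y} → x ≈ y → x ᶜ ≈ y ᶜ
      conj-+          : ∀ x y → (x + y) ᶜ ≈ x ᶜ + y ᶜ
      conj-*          : ∀ x y → (x * y) ᶜ ≈ x ᶜ * y ᶜ
      conj-1          : 1# ᶜ ≈ 1#
      conj-involutive : ∀ x → (x ᶜ) ᶜ ≈ x

  -- The long solver identities below end in multiples of expressions known to vanish; each
  -- application removes one such summand.
  drop-multiple : ∀ {x e} k → e ≈ 0# → x + k * e ≈ x
  drop-multiple k e≈0 = trans (+-congˡ (trans (*-congˡ e≈0) (zeroʳ k))) (+-identityʳ _)

  module NonFixed (_ᶜ : Carrier → Carrier) (isInvolution : IsInvolution _ᶜ) (r : Carrier) (r̄≉r : ¬ (r ᶜ ≈ r)) where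
    open IsInvolution isInvolution

    Fixed : Carrier → Set ℓ
    Fixed x = x ᶜ ≈ x

    -- The conjugate, trace and norm of `r`.
    s t N : Carrier
    s = r ᶜ
    t = r + s
    N = r * s

    w v f : Carrier → Carrier
    w x = inv (x + r)
    v x = inv (x + s)
    f x = x + w x + v x

    conj-0 : 0# ᶜ ≈ 0#
    conj-0 = trans (conj-cong (sym 1+1≈0)) (trans (conj-+ 1# 1#) (trans (+-cong conj-1 conj-1) 1+1≈0))

    conj-≉0 : ∀ {x} → ¬ (x ≈ 0#) → ¬ (x ᶜ ≈ 0#)
    conj-≉0 x≉0 x̄≈0 = x≉0 (trans (sym (conj-involutive _)) (trans (conj-cong x̄≈0) conj-0))

    conj-inv : ∀ x → (inv x) ᶜ ≈ inv (x ᶜ)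
    conj-inv x with x ≟ 0#
    ... | yes x≈0 = trans conj-0 (sym (inv-zero (trans (conj-cong x≈0) conj-0)))
    ... | no  x≉0 = sym (inv-unique (trans (sym (conj-* _ _)) (trans (conj-cong (⁻¹-inverse x x≉0)) conj-1)))

    Fixed-cong : ∀ {x y} → x ≈ y → Fixed x → Fixed y
    Fixed-cong x≈y x̄≈x = trans (conj-cong (sym x≈y)) (trans x̄≈x x≈y)

    Fixed-+ : ∀ {x y} → Fixed x → Fixed y → Fixed (x + y)
    Fixed-+ x̄≈x ȳ≈y = trans (conj-+ _ _) (+-cong x̄≈x ȳ≈y)

    Fixed-* : ∀ {x y} → Fixed x → Fixed y → Fixed (x * y)
    Fixed-* x̄≈x ȳ≈y = trans (conj-* _ _) (*-cong x̄≈x ȳ≈y)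

    Fixed-inv : ∀ {x} → Fixed x → Fixed (inv x)
    Fixed-inv x̄≈x = trans (conj-inv _) (inv-cong x̄≈x)

    Fixed-t : Fixed t
    Fixed-t = trans (conj-+ r s) (trans (+-congˡ (conj-involutive r)) (+-comm s r))

    Fixed-N : Fixed N
    Fixed-N = trans (conj-* r s) (trans (*-congˡ (conj-involutive r)) (*-comm s r))

    t≉0 : ¬ (t ≈ 0#)
    t≉0 t≈0 = r̄≉r (sym (x+y≈0⇒x≈y t≈0))

    r≉0 : ¬ (r ≈ 0#)
    r≉0 r≈0 = r̄≉r (Fixed-cong (sym r≈0) conj-0)

    N≉0 : ¬ (N ≈ 0#)
    N≉0 = *-≉0 r≉0 (conj-≉0 r≉0)

    x+r≉0 : ∀ {x} → Fixed x → ¬ (x + r ≈ 0#)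
    x+r≉0 x̄≈x x+r≈0 = r̄≉r (Fixed-cong (x+y≈0⇒x≈y x+r≈0) x̄≈x)

    conj-x+r : ∀ {x} → Fixed x → (x + r) ᶜ ≈ x + s
    conj-x+r x̄≈x = trans (conj-+ _ r) (+-congʳ x̄≈x)

    x+s≉0 : ∀ {x} → Fixed x → ¬ (x + s ≈ 0#)
    x+s≉0 x̄≈x = conj-≉0 (x+r≉0 x̄≈x) ∘ trans (conj-x+r x̄≈x)

    -- The defining relation of the inverse, put in the vanishing form that `drop-multiple`
    -- consumes.
    w-eq : ∀ {x} → Fixed x → (x + r) * w x + 1# ≈ 0#
    w-eq = x≈y⇒x+y≈0 ∘ inv-inverseʳ ∘ x+r≉0

    v-eq : ∀ {x} → Fixed x → (x + s) * v x + 1# ≈ 0#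
    v-eq = x≈y⇒x+y≈0 ∘ inv-inverseʳ ∘ x+s≉0

    w-cong : ∀ {x y} → x ≈ y → w x ≈ w y
    w-cong = inv-cong ∘ +-congʳ

    -- Conjugation exchanges `w x` and `v x`, so their sum is fixed.
    Fixed-f : ∀ {x} → Fixed x → Fixed (f x)
    Fixed-f {x} x̄≈x = begin
      (x + w x + v x) ᶜ         ≈⟨ trans (conj-+ _ _) (+-congʳ (conj-+ _ _)) ⟩
      x ᶜ + (w x) ᶜ + (v x) ᶜ     ≈⟨ +-cong (+-cong x̄≈x w̄≈v) v̄≈w ⟩
      x + v x + w x            ≈⟨ solve 3 (λ x w v → x :+ v :+ w := x :+ w :+ v) refl x (w x) (v x) ⟩
      x + w x + v x            ∎
      where
      w̄≈v : (w x) ᶜ ≈ v x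
      w̄≈v = trans (conj-inv _) (inv-cong (conj-x+r x̄≈x))
      v̄≈w : (v x) ᶜ ≈ w x
      v̄≈w = trans (conj-cong (sym w̄≈v)) (conj-involutive _)

    -- Trace one implies injectivity

    module _ (t≈1 : t ≈ 1#) where

      f-injective : ∀ {x y} → Fixed x → Fixed y → f x ≈ f y → x ≈ y
      f-injective {x} {y} x̄≈x ȳ≈y fx≈fy =
        [ x+y≈0⇒x≈y , [ A≈0⇒x≈y , A≈0⇒x≈y ∘ Ā≈0⇒A≈0 ]′ ∘ *-zero-divisor-free ]′
          (*-zero-divisor-free d*[A*Ā]≈0)
        where
        u ū A Ā : Carrier
        u = x + r
        ū = x + s
        A = u * (x + y) + (u * ū + 1#)
        Ā = ū * (x + y) + (u * ū + 1#)

        Ā-conj : A ᶜ ≈ Ā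
        Ā-conj = begin
          (u * (x + y) + (u * ū + 1#)) ᶜ
            ≈⟨ trans (conj-+ _ _) (+-cong (conj-* _ _) (trans (conj-+ _ _) (+-cong (conj-* _ _) conj-1))) ⟩
          u ᶜ * (x + y) ᶜ + (u ᶜ * ū ᶜ + 1#)
            ≈⟨ +-cong (*-cong ue (Fixed-+ x̄≈x ȳ≈y)) (+-congʳ (*-cong ue (trans (conj-cong (sym ue)) (conj-involutive u)))) ⟩
          ū * (x + y) + (ū * u + 1#)
            ≈⟨ +-congˡ (+-congʳ (*-comm ū u)) ⟩
          Ā ∎
          where
          ue : u ᶜ ≈ ū
          ue = conj-x+r x̄≈x

        Ā≈0⇒A≈0 : Ā ≈ 0# → A ≈ 0#
        Ā≈0⇒A≈0 Ā≈0 = trans (sym (conj-involutive A)) (trans (conj-cong (trans Ā-conj Ā≈0)) conj-0)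

        -- `A` and its conjugate vanish together. The common part `u * ū + 1#` cancels in their sum,
        -- leaving `t * (x + y)`, which is `x + y` for trace one.
        A≈0⇒x≈y : A ≈ 0# → x ≈ y
        A≈0⇒x≈y A≈0 = x+y≈0⇒x≈y (begin
          x + y                            ≈⟨ drop-multiple (x + y) (x≈y⇒x+y≈0 t≈1) ⟨
          (x + y) + (x + y) * (t + 1#)
            ≈⟨ solve 4 (λ x y r s →
                 (x :+ y) :+ (x :+ y) :* (r :+ s :+ con true) :=
                 ((x :+ r) :* (x :+ y) :+ ((x :+ r) :* (x :+ s) :+ con true)) :+
                 ((x :+ s) :* (x :+ y) :+ ((x :+ r) :* (x :+ s) :+ con true))) refl x y r s ⟩
          A + Ā                            ≈⟨ +-cong A≈0 (trans (sym Ā-conj) (trans (conj-cong A≈0) conj-0)) ⟩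
          0# + 0#                          ≈⟨ +-identityˡ 0# ⟩
          0#                               ∎)

        d*[A*Ā]≈0 : (x + y) * (A * Ā) ≈ 0#
        d*[A*Ā]≈0 = begin
          (x + y) * (A * Ā)
            -- Because `u + ū = t`, clearing denominators in `f x + f y` leaves `x + y` times the
            -- sum of `A * Ā` and the square of `t + 1#`. The last summand removes that square, and
            -- the four before it account for the inverses. The leading zero is what remains after
            -- all multiples are dropped.
            ≈⟨ solve 8 (λ x y r s wx vx wy vy →
                 (x :+ y) :* (((x :+ r) :* (x :+ y) :+ ((x :+ r) :* (x :+ s) :+ con true)) :*
                              ((x :+ s) :* (x :+ y) :+ ((x :+ r) :* (x :+ s) :+ con true))) :=
                 con false
                 :+ (x :+ r) :* (x :+ s) :* (y :+ r) :* (y :+ s) :* ((x :+ wx :+ vx) :+ (y :+ wy :+ vy))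
                 :+ (x :+ s) :* (y :+ r) :* (y :+ s) :* ((x :+ r) :* wx :+ con true)
                 :+ (x :+ r) :* (y :+ r) :* (y :+ s) :* ((x :+ s) :* vx :+ con true)
                 :+ (x :+ r) :* (x :+ s) :* (y :+ s) :* ((y :+ r) :* wy :+ con true)
                 :+ (x :+ r) :* (x :+ s) :* (y :+ r) :* ((y :+ s) :* vy :+ con true)
                 :+ (x :+ y) :* (r :+ s :+ con true) :* (r :+ s :+ con true))
                 refl x y r s (w x) (v x) (w y) (v y) ⟩
          0#
            + (x + r) * (x + s) * (y + r) * (y + s) * (f x + f y)
            + (x + s) * (y + r) * (y + s) * ((x + r) * w x + 1#)
            + (x + r) * (y + r) * (y + s) * ((x + s) * v x + 1#)
            + (x + r) * (x + s) * (y + s) * ((y + r) * w y + 1#)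
            + (x + r) * (x + s) * (y + r) * ((y + s) * v y + 1#)
            + (x + y) * (t + 1#) * (t + 1#)
            ≈⟨ trans (drop-multiple _ (x≈y⇒x+y≈0 t≈1))
               (trans (drop-multiple _ (v-eq ȳ≈y)) (trans (drop-multiple _ (w-eq ȳ≈y))
               (trans (drop-multiple _ (v-eq x̄≈x)) (trans (drop-multiple _ (w-eq x̄≈x))
               (drop-multiple _ (x≈y⇒x+y≈0 fx≈fy)))))) ⟩
          0# ∎

    -- Sums over the fixed elements

    module _ (E : FiniteSet.Enumeration setoid Fixed) where
      open Enumeration E
      open SemiringSum semiring using (sum; sum-cong-≋; ∑-distrib-+; *-distribˡ-sum)

      ∑ : (Carrier → Carrier) → Carrier
      ∑ h = sum (h ∘ elem)

      ∑-cong : ∀ {g h : Carrier → Carrier} → (∀ {x} → Fixed x → g x ≈ h x) → ∑ g ≈ ∑ h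
      ∑-cong g≈h = sum-cong-≋ (λ i → g≈h (elem-∈ i))

      ∑-+ : ∀ g h → ∑ (λ x → g x + h x) ≈ ∑ g + ∑ h
      ∑-+ g h = ∑-distrib-+ (g ∘ elem) (h ∘ elem)

      ∑-* : ∀ k h → ∑ (λ x → k * h x) ≈ k * ∑ h
      ∑-* k h = sym (*-distribˡ-sum k (h ∘ elem))

      ∑1≈0 : ∑ (λ _ → 1#) ≈ 0#
      ∑1≈0 = sum-ones≈0 E (λ x̄≈x → Fixed-+ x̄≈x conj-1)

      -- Squaring is additive in characteristic two.
      ∑-square : ∀ h → ∑ (λ x → h x * h x) ≈ ∑ h * ∑ h
      ∑-square h = go (h ∘ elem)
        where
        go : ∀ {n} (a : Fin n → Carrier) → sum (λ i → a i * a i) ≈ sum a * sum a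
        go {zero}  a = sym (zeroˡ 0#)
        go {suc n} a = trans (+-congˡ (go (a ∘ suc)))
          (solve 2 (λ x y → x :* x :+ y :* y := (x :+ y) :* (x :+ y)) refl (a zero) (sum (a ∘ suc)))

      -- Indicator of `t`, the correction term at the one point where the formula for `w (φ x)`
      -- breaks down.
      [_≈t] : Carrier → Carrier
      [ x ≈t] = if does (x ≟ t) then 1# else 0#

      [≈t]-yes : ∀ {x} → x ≈ t → [ x ≈t] ≈ 1#
      [≈t]-yes {x} x≈t with x ≟ t
      ... | yes _   = refl
      ... | no  x≉t = ⊥-elim (x≉t x≈t)

      [≈t]-no : ∀ {x} → ¬ (x ≈ t) → [ x ≈t] ≈ 0#
      [≈t]-no {x} x≉t with x ≟ t
      ... | yes x≈t = ⊥-elim (x≉t x≈t)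
      ... | no  _   = refl

      ∑[≈t]≈1 : ∑ [_≈t] ≈ 1#
      ∑[≈t]≈1 with position Fixed-t
      ... | j , ej≈t = trans
        (FiniteSum.sum-single +-commutativeMonoid ([_≈t] ∘ elem) j
          (λ i i≢j → [≈t]-no (λ ei≈t → i≢j (elem-inj (trans ei≈t (sym ej≈t))))))
        ([≈t]-yes ej≈t)

      -- In the basis 1, r multiplication by r maps the line spanned by x + r to that
      -- spanned by φ x + r, except that x = t is sent to ∞ and ∞ to 0 = φ t.
      φ : Carrier → Carrier
      φ x = N * inv (t + x)

      Fixed-φ : ∀ {x} → Fixed x → Fixed (φ x)
      Fixed-φ x̄≈x = Fixed-* Fixed-N (Fixed-inv (Fixed-+ Fixed-t x̄≈x))

      φ-injective : ∀ {x y} → φ x ≈ φ y → x ≈ y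
      φ-injective eq = ∙-cancelˡ t _ _ (inv-injective
        (*-cancelʳ-≉0 N≉0 (trans (*-comm _ N) (trans eq (*-comm N _)))))
        where open GroupProperties +-group using (∙-cancelˡ)

      -- Since `t + s = r`, for `x` other than `t` the sum `φ x + r` is `r * (x + r)` divided by
      -- `t + x`. Inverting gives `(t + x) * w x` for the left side, and `t + x` is `(x + r) + s`.
      w-φ : ∀ {x} → Fixed x → r * w (φ x) ≈ 1# + s * w x + [ x ≈t]
      w-φ {x} x̄≈x with x ≟ t
      -- As `inv` is zero at zero, `φ x` is zero here and the left side is `r` over `r`. On the
      -- right `s * w x` is also one, so `1# + s * w x` vanishes and the indicator supplies the
      -- missing one.
      ... | yes x≈t = begin
        r * w (φ x)          ≈⟨ divide (x+r≉0 (Fixed-φ x̄≈x)) (trans (*-identityʳ _) φx+r≈r) ⟩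
        1#                   ≈⟨ solve 0 (con true := con true :+ con true :+ con true) refl ⟩
        1# + 1# + 1#         ≈⟨ +-congʳ (+-congˡ (divide (x+r≉0 x̄≈x) (trans (*-identityʳ _) x+r≈s))) ⟨
        1# + s * w x + 1#    ∎
        where
        x+r≈s : x + r ≈ s
        x+r≈s = trans (+-congʳ x≈t) (solve 2 (λ r s → r :+ s :+ r := s) refl r s)
        φx+r≈r : φ x + r ≈ r
        φx+r≈r = trans (+-congʳ (trans (*-congˡ (inv-zero (x≈y⇒x+y≈0 (sym x≈t)))) (zeroʳ N))) (+-identityˡ r)
      ... | no x≉t = trans (divide (x+r≉0 (Fixed-φ x̄≈x)) (begin
        (N * i + r) * (1# + s * w x)
          ≈⟨ solve 5 (λ r s x i w →
               (r :* s :* i :+ r) :* (con true :+ s :* w) :=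
               r :+ r :* s :* i :* ((x :+ r) :* w :+ con true) :+ r :* s :* w :* ((r :+ s :+ x) :* i :+ con true))
               refl r s x i (w x) ⟩
        r + N * i * ((x + r) * w x + 1#) + N * w x * ((t + x) * i + 1#)
          ≈⟨ trans (drop-multiple _ (x≈y⇒x+y≈0 (inv-inverseʳ (x≉t ∘ sym ∘ x+y≈0⇒x≈y)))) (drop-multiple _ (w-eq x̄≈x)) ⟩
        r ∎)) (sym (+-identityʳ _))
        where
        i : Carrier
        i = inv (t + x)

      p : Carrier
      p = ∑ w

      -- Summing `w-φ` over the fixed elements, which `φ` permutes, gives `r * p = s * p + 1#`: the
      -- constant term sums to zero and the indicator to one.
      t*p≈1 : t * p ≈ 1#
      t*p≈1 = begin
        t * p                         ≈⟨ distribʳ p r s ⟩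
        r * p + s * p                 ≈⟨ +-congʳ rp ⟩
        0# + s * p + 1# + s * p       ≈⟨ solve 1 (λ a → con false :+ a :+ con true :+ a := con true) refl (s * p) ⟩
        1#                            ∎
        where
        open SelfMap E φ Fixed-φ (λ _ _ → φ-injective)
        rp : r * p ≈ 0# + s * p + 1#
        rp = begin
          r * p                                    ≈⟨ *-congˡ (sum-reindex +-commutativeMonoid w w-cong) ⟨
          r * ∑ (w ∘ φ)                            ≈⟨ ∑-* r (w ∘ φ) ⟨
          ∑ (λ x → r * w (φ x))                    ≈⟨ ∑-cong w-φ ⟩
          ∑ (λ x → 1# + s * w x + [ x ≈t])
            ≈⟨ trans (∑-+ (λ x → 1# + s * w x) [_≈t]) (+-congʳ (∑-+ (λ _ → 1#) (λ x → s * w x))) ⟩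
          ∑ (λ _ → 1#) + ∑ (λ x → s * w x) + ∑ [_≈t] ≈⟨ +-cong (+-cong ∑1≈0 (∑-* s w)) ∑[≈t]≈1 ⟩
          0# + s * p + 1#                          ∎

      -- `v x` is `w (x + t)`, and translation by `t` permutes the fixed elements.
      ∑-v : ∀ (h : Carrier → Carrier) → (∀ {x y} → x ≈ y → h x ≈ h y) → ∑ (h ∘ v) ≈ ∑ (h ∘ w)
      ∑-v h h-cong = trans (∑-cong (λ {x} _ → h-cong (inv-cong
          (solve 3 (λ x r s → x :+ s := x :+ (r :+ s) :+ r) refl x r s))))
        (sum-reindex +-commutativeMonoid (h ∘ w) (h-cong ∘ w-cong))
        where
        open GroupProperties +-group using (∙-cancelʳ)
        open SelfMap E (_+ t) (λ x̄≈x → Fixed-+ x̄≈x Fixed-t) (λ _ _ → ∙-cancelʳ t _ _)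

      -- The third power sum of f

      sq cube : Carrier → Carrier
      sq y   = y * y
      cube y = y * y * y

      sq-cong : ∀ {x y} → x ≈ y → sq x ≈ sq y
      sq-cong x≈y = *-cong x≈y x≈y

      cube-cong : ∀ {x y} → x ≈ y → cube x ≈ cube y
      cube-cong x≈y = *-cong (sq-cong x≈y) x≈y

      -- Partial fractions: `x + r` and `x + s` differ by `t`, so `w x * v x` is `z * (w x + v x)`.
      z : Carrier
      z = inv t

      -- The partial fraction expansion of `cube (f x) + cube x`, sorted by degree in `w x` and
      -- `v x`. The explicit factors `1#` give the terms the shape to which `∑-*` and `∑-pair`
      -- apply.
      linear quadratic cubic cubeDefect : Carrier → Carrier
      linear x     = (r * r + 1#) * w x + (s * s + 1#) * v x
      quadratic x  = (r + z) * sq (w x) + (s + z) * sq (v x)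
      cubic x      = 1# * cube (w x) + 1# * cube (v x)
      cubeDefect x = t * 1# + linear x + quadratic x + cubic x

      -- The relations `x * w x = 1# + r * w x` and `x * v x = 1# + s * v x` eliminate `x` from the
      -- mixed terms, and `t * z = 1#` splits the products of `w x` and `v x`.
      cube-f : ∀ {x} → Fixed x → cube (f x) ≈ cube x + cubeDefect x
      cube-f {x} x̄≈x = begin
        cube (f x)
          ≈⟨ solve 6 (λ x r s w v z →
               (x :+ w :+ v) :* (x :+ w :+ v) :* (x :+ w :+ v) :=
               x :* x :* x :+ ((r :+ s) :* con true :+ ((r :* r :+ con true) :* w :+ (s :* s :+ con true) :* v)
                     :+ ((r :+ z) :* (w :* w) :+ (s :+ z) :* (v :* v)) :+ (con true :* (w :* w :* w) :+ con true :* (v :* v :* v)))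
               :+ (r :+ x :+ w :+ (w :+ v) :* z :* v) :* ((x :+ r) :* w :+ con true)
               :+ (s :+ x :+ v :+ (w :+ v) :* z :* w) :* ((x :+ s) :* v :+ con true)
               :+ (w :+ v) :* w :* v :* ((r :+ s) :* z :+ con true)) refl x r s (w x) (v x) z ⟩
        cube x + cubeDefect x
          + (r + x + w x + (w x + v x) * z * v x) * ((x + r) * w x + 1#)
          + (s + x + v x + (w x + v x) * z * w x) * ((x + s) * v x + 1#)
          + (w x + v x) * w x * v x * (t * z + 1#)
          ≈⟨ trans (drop-multiple _ (x≈y⇒x+y≈0 (inv-inverseʳ t≉0)))
             (trans (drop-multiple _ (v-eq x̄≈x)) (drop-multiple _ (w-eq x̄≈x))) ⟩
        cube x + cubeDefect x ∎

      -- By `∑-v` both halves of each part have the same power sum, so their coefficients add: to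
      -- `t * t` in the linear part, to `t` in the quadratic part, where `z` cancels, and to zero in
      -- the cubic part.
      ∑-cubeDefect : ∑ cubeDefect ≈ t * t * p + t * (p * p)
      ∑-cubeDefect = begin
        ∑ cubeDefect
          ≈⟨ trans (∑-+ (λ x → t * 1# + linear x + quadratic x) cubic)
             (+-congʳ (trans (∑-+ (λ x → t * 1# + linear x) quadratic)
             (+-congʳ (∑-+ (λ _ → t * 1#) linear)))) ⟩
        ∑ (λ _ → t * 1#) + ∑ linear + ∑ quadratic + ∑ cubic
          ≈⟨ +-cong (+-cong (+-cong (trans (∑-* t (λ _ → 1#)) (*-congˡ ∑1≈0))
               (∑-pair id id _ _)) (trans (∑-pair sq sq-cong _ _) (+-cong (*-congˡ (∑-square w)) (*-congˡ (∑-square w)))))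
               (∑-pair cube cube-cong _ _) ⟩
        t * 0# + ((r * r + 1#) * p + (s * s + 1#) * p)
          + ((r + z) * (p * p) + (s + z) * (p * p)) + (1# * ∑ (cube ∘ w) + 1# * ∑ (cube ∘ w))
          ≈⟨ solve 5 (λ r s z p c →
               (r :+ s) :* con false :+ ((r :* r :+ con true) :* p :+ (s :* s :+ con true) :* p)
                 :+ ((r :+ z) :* (p :* p) :+ (s :+ z) :* (p :* p)) :+ (con true :* c :+ con true :* c) :=
               (r :+ s) :* (r :+ s) :* p :+ (r :+ s) :* (p :* p)) refl r s z p (∑ (cube ∘ w)) ⟩
        t * t * p + t * (p * p) ∎
        where
        ∑-pair : ∀ (h : Carrier → Carrier) → (∀ {x y} → x ≈ y → h x ≈ h y) → ∀ a b →
                 ∑ (λ x → a * h (w x) + b * h (v x)) ≈ a * ∑ (h ∘ w) + b * ∑ (h ∘ w)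
        ∑-pair h h-cong a b = trans (∑-+ (λ x → a * h (w x)) (λ x → b * h (v x)))
          (+-cong (∑-* a (h ∘ w)) (trans (∑-* b (h ∘ v)) (*-congˡ (∑-v h h-cong))))

      f-injective⇒t≈1 : (∀ {x y} → Fixed x → Fixed y → f x ≈ f y → x ≈ y) → t ≈ 1#
      f-injective⇒t≈1 f-inj = x+y≈0⇒x≈y ([ id , id ]′ (*-zero-divisor-free (begin
        (t + 1#) * (t + 1#)
          -- Multiplying the vanishing defect by `t` and substituting `t * p = 1#` turns it into
          -- `t * t + 1#`, the square of `t + 1#`.
          ≈⟨ solve 2 (λ t p → (t :+ con true) :* (t :+ con true) :=
               con false :+ t :* (t :* t :* p :+ t :* (p :* p))
               :+ (t :* t :+ t :* p :+ con true) :* (t :* p :+ con true)) refl t p ⟩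
        0# + t * (t * t * p + t * (p * p)) + (t * t + t * p + 1#) * (t * p + 1#)
          ≈⟨ trans (drop-multiple _ (x≈y⇒x+y≈0 t*p≈1)) (drop-multiple t defect≈0) ⟩
        0# ∎)))
        where
        open SelfMap E f Fixed-f f-inj
        open GroupProperties +-group using (identityʳ-unique)
        defect≈0 : t * t * p + t * (p * p) ≈ 0#
        defect≈0 = trans (sym ∑-cubeDefect) (identityʳ-unique (∑ cube) _ (begin
          ∑ cube + ∑ cubeDefect              ≈⟨ ∑-+ cube cubeDefect ⟨
          ∑ (λ x → cube x + cubeDefect x)    ≈⟨ ∑-cong cube-f ⟨
          ∑ (cube ∘ f)                       ≈⟨ sum-reindex +-commutativeMonoid cube cube-cong ⟩
          ∑ cube                             ∎))

-- The field of order q squared and its Frobenius involution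

module QuadraticExtension {c ℓ} (K : Field c ℓ) (n : ℕ) (card : HasCard K ((2 ^ℕ n) ^ℕ 2)) where
  open Field K hiding (zero)

  q : ℕ
  q = 2 ^ℕ n

  allElements : FiniteSet.Enumeration setoid (λ _ → ⊤)
  allElements = FiniteSet.enumerate setoid (proj₁ card) (All.universal _ _)
    (proj₁ (proj₂ (proj₂ card))) (λ {x} _ → proj₂ (proj₂ (proj₂ card)) x)

  _≟_ : Decidable _≈_
  x ≟ y with FiniteSet.Enumeration.position allElements {x} tt | FiniteSet.Enumeration.position allElements {y} tt
  ... | i , ei≈x | j , ej≈y with i ≟ᶠ j
  ...   | yes ≡.refl = yes (trans (sym ei≈x) ej≈y)
  ...   | no  i≢j    = no λ x≈y → i≢j
            (FiniteSet.Enumeration.elem-inj allElements (trans ei≈x (trans x≈y (sym ej≈y))))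

  open DiscreteField K _≟_
  open Everything allElements

  size≡q*q : Enumeration.size allElements ≡ q *ℕ q
  size≡q*q = ≡.trans (proj₁ (proj₂ card)) (≡.cong (q *ℕ_) (*ℕ-identityʳ q))

  1+1≈0 : 1# + 1# ≈ 0#
  1+1≈0 = 2^m·1≈0⇒1+1≈0 (n +ℕ n) (trans
    (reflexive (≡.cong (_· 1#) (≡.trans (^-distribˡ-+-* 2 n n) (≡.sym size≡q*q))))
    size·1≈0)
    where open SemiringMult semiring using () renaming (_×_ to _·_)

  open CharTwo commRing 1+1≈0
  open Involution K _≟_ 1+1≈0

  -- Iterated squaring, each step additive in characteristic two.
  frobenius-+ : ∀ m x y → (x + y) ^ (2 ^ℕ m) ≈ (x ^ (2 ^ℕ m)) + (y ^ (2 ^ℕ m))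
  frobenius-+ zero    x y = distribʳ 1# x y
  frobenius-+ (suc m) x y = begin
    (x + y) ^ (2 *ℕ k)                   ≈⟨ ^-* (x + y) 2 k ⟩
    ((x + y) ^ k) ^ 2                    ≈⟨ ^-cong 2 (frobenius-+ m x y) ⟩
    ((x ^ k) + (y ^ k)) ^ 2
      ≈⟨ solve 2 (λ a b → (a :+ b) :* ((a :+ b) :* con true) :=
           a :* (a :* con true) :+ b :* (b :* con true)) refl (x ^ k) (y ^ k) ⟩
    ((x ^ k) ^ 2) + ((y ^ k) ^ 2)        ≈⟨ +-cong (^-* x 2 k) (^-* y 2 k) ⟨
    (x ^ (2 *ℕ k)) + (y ^ (2 *ℕ k))      ∎
    where
    open SetoidReasoning setoid
    open Solver using (solve; _:=_; _:+_; _:*_; con)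
    k : ℕ
    k = 2 ^ℕ m

  frobenius-isInvolution : IsInvolution (_^ q)
  frobenius-isInvolution = record
    { conj-cong       = ^-cong q
    ; conj-+          = frobenius-+ n
    ; conj-*          = λ x y → ^-distrib-* x y q
    ; conj-1          = 1^n≈1 q
    -- Applying the map twice raises to the power `q * q`, the order of the field, so `fermat`
    -- applies.
    ; conj-involutive = λ x → trans (sym (^-* x q q))
        (trans (reflexive (≡.cong (x ^_) (≡.sym size≡q*q))) (fermat x))
    }

  Fq : Enumeration (InFq K q)
  Fq = enumerate (filter inFq? (proj₁ card)) (all-filter inFq? (proj₁ card))
    (AllPairs-filter⁺ inFq? (proj₁ (proj₂ (proj₂ card))))
    (λ {x} → ∈-filter⁺ setoid inFq? (λ x≈y x̄≈x → trans (^-cong q (sym x≈y)) (trans x̄≈x x≈y))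
               (proj₂ (proj₂ (proj₂ card)) x))
    where
    inFq? : ∀ x → Dec (InFq K q x)
    inFq? x = (x ^ q) ≟ x

  -- The induced map on the projective line

  module _ (r : Carrier) (r∉Fq : ¬ InFq K q r) where
    open NonFixed (_^ q) frobenius-isInvolution r r∉Fq

    fValue : Carrier → Carrier
    fValue x = x + (1# ÷ (x - r)) + (1# ÷ (x - (r ^ q)))

    -- Subtraction is addition here, and the denominators are nonzero on the subfield, where `_⁻¹`
    -- and `inv` agree.
    fValue≈f : ∀ {x} → InFq K q x → fValue x ≈ f x
    fValue≈f x∈ = +-cong
      (+-congˡ (trans (*-identityˡ _) (⁻¹≈inv (x+r≉0 x∈) (+-congˡ (-x≈x r)))))
      (trans (*-identityˡ _) (⁻¹≈inv (x+s≉0 x∈) (+-congˡ (-x≈x (r ^ q)))))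

    permutes⇒t≈1 : PermutesP1Fq K q (fMap K q r) → t ≈ 1#
    permutes⇒t≈1 (_ , inj , _) = f-injective⇒t≈1 Fq λ {x} {y} x∈ y∈ fx≈fy →
      inj (just x) (just y) x∈ y∈ (trans (fValue≈f x∈) (trans fx≈fy (sym (fValue≈f y∈))))

    t≈1⇒permutes : t ≈ 1# → PermutesP1Fq K q (fMap K q r)
    t≈1⇒permutes t≈1 = closed , injective , surjective
      where
      closed : ∀ a → InP1Fq K q a → InP1Fq K q (fMap K q r a)
      closed nothing  _  = _
      closed (just x) x∈ = Fixed-cong (sym (fValue≈f x∈)) (Fixed-f x∈)

      injective : ∀ a b → InP1Fq K q a → InP1Fq K q b → _≈P_ K q (fMap K q r a) (fMap K q r b) → _≈P_ K q a b
      -- The mixed cases are absurd: `fMap` fixes infinity and keeps finite points finite.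
      injective nothing  nothing  _  _  _  = _
      injective (just x) (just y) x∈ y∈ eq =
        f-injective t≈1 x∈ y∈ (trans (sym (fValue≈f x∈)) (trans eq (fValue≈f y∈)))

      surjective : ∀ b → InP1Fq K q b → ∃ λ a → InP1Fq K q a × _≈P_ K q (fMap K q r a) b
      surjective nothing  _  = nothing , _ , _
      surjective (just y) y∈ = just x , x∈ , trans (fValue≈f x∈) fx≈y
        where
        preimage : ∃ λ x → InFq K q x × f x ≈ y
        -- The subfield is finite, so injectivity of `f` on it already yields a preimage.
        preimage = SelfMap.surjective Fq f Fixed-f (f-injective t≈1) y∈
        x    = proj₁ preimage
        x∈   = proj₁ (proj₂ preimage)
        fx≈y = proj₂ (proj₂ preimage)

theorem3p2 : ∀ {c ℓ} (K : Field c ℓ) (n : ℕ) → n ≥ 1 →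
    HasCard K ((2 ^ℕ n) ^ℕ 2) →
    (r : Field.Carrier K) → ¬ InFq K (2 ^ℕ n) r →
    PermutesP1Fq K (2 ^ℕ n) (fMap K (2 ^ℕ n) r)
    ⇔ Field._≈_ K (Field._+_ K r (Field._^_ K r (2 ^ℕ n))) (Field.1# K)
theorem3p2 K n _ card r r∉Fq = mk⇔ (permutes⇒t≈1 r r∉Fq) (t≈1⇒permutes r r∉Fq)
  where open QuadraticExtension K n card
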